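{- Let $G$ be a connected graph. Then $G$ is chordal if and only if there exists $G_c\in\widetilde{H}(G)$ that is a tree. Moreover, if $G$ is chordal, then for every $G_c\in\widetilde{H}(G)$ and every leaf of $G_c$, the maximal clique of $G$ corresponding to that leaf has a vertex in its non-public part.
   Context: A graph is chordal if every cycle of length at least $4$ has a chord, i.e. an edge joining two nonadjacent vertices of the cycle. Clique graph: for a connected graph $G$, a clique graph $G_c$ has one vertex $v_C$ for each maximal clique $C$ of $G$. It is constructed as follows. - Start with $G'=\emptyset$ and $G_c=\emptyset$. - Repeatedly choose a maximal clique $C$ of $G$ not contained in $G'$. - If $V(C)\cap V(G')=\emptyset$, set $G'=G'\cup C$ and add the vertex $v_C$ to $G_c$. - Otherwise, let $S_1,\dots,S_k$ be the cliques of $G'$ at which $C$ meets $G'$, i.e. the maximal cliques of $G'[V(C)\cap V(G')]$. For each $i$ choose a maximal clique $C_i$ of $G$ with $S_i\subseteq C_i$, and let $v_{C_i}$ be its vertex in $G_c$. Set $G'=G'\cup C$, add $v_C$ to $G_c$, and add the edges $v_Cv_{C_i}$ for $1\le i\le k$. - Stop when $G'=G$ and output $G_c$. $\widetilde{H}(G)$ denotes the set of all clique graphs obtainable this way over all orders of clique selection and choices. A vertex $v$ of a maximal clique $C$ is in the public part of $C$ if $v$ belongs to some other maximal clique of $G$; otherwise it is in the non-public part of $C$. A leaf is a vertex of degree $1$. -}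

module Defs where

open import Level using (0ℓ)
open import Data.Nat using (ℕ; zero; suc; _≤_)
open import Data.Fin using (Fin; toℕ)
open import Data.Fin.Subset using (Subset; _∈_; _⊆_)
open import Data.List using (List; []; _∷_; length; lookup)
open import Data.List.Relation.Unary.Any using (Any)
open import Data.List.Membership.Propositional using () renaming (_∈_ to _∈ₗ_)
open import Data.Product using (Σ; Σ-syntax; ∃; ∃-syntax; _×_)
open import Data.Sum using (_⊎_)
open import Data.Empty using (⊥)
open import Relation.Nullary using (¬_)
open import Relation.Binary using (Decidable)
open import Relation.Binary.PropositionalEquality using (_≡_; _≢_)
open import Relation.Binary.Construct.Closure.ReflexiveTransitive using (Star)

record Graph (n : ℕ) : Set₁ where
  field
    Adj    : Fin n → Fin n → Set
    sym    : ∀ {x y} → Adj x y → Adj y x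
    irrefl : ∀ {x} → ¬ Adj x x
    dec    : Decidable Adj

ConnectedRel : ∀ {m} → (Fin m → Fin m → Set) → Set
ConnectedRel {m} R = Fin m × (∀ x y → Star R x y)

Consec : ∀ {k} → Fin k → Fin k → Set
Consec {k} i j = (suc (toℕ i) ≡ toℕ j) ⊎ ((suc (toℕ i) ≡ k) × (toℕ j ≡ 0))

IsCycle : ∀ {m} → (Fin m → Fin m → Set) → (k : ℕ) → (Fin k → Fin m) → Set
IsCycle R k f = (∀ {i j} → f i ≡ f j → i ≡ j) × (∀ i j → Consec i j → R (f i) (f j))

HasChord : ∀ {m} → (Fin m → Fin m → Set) → (k : ℕ) → (Fin k → Fin m) → Set
HasChord R k f = Σ[ i ∈ Fin _ ] Σ[ j ∈ Fin _ ]
  (i ≢ j × ¬ Consec i j × ¬ Consec j i × R (f i) (f j))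

IsTree : ∀ {m} → (Fin m → Fin m → Set) → Set
IsTree {m} R = ConnectedRel R × (∀ k → 3 ≤ k → (f : Fin k → Fin m) → ¬ IsCycle R k f)

IsLeaf : ∀ {m} → (Fin m → Fin m → Set) → Fin m → Set
IsLeaf R i = Σ[ j ∈ Fin _ ] (R i j × (∀ j' → R i j' → j' ≡ j))

module _ {n : ℕ} (G : Graph n) where
  open Graph G

  Connected : Set
  Connected = ConnectedRel Adj

  Chordal : Set
  Chordal = ∀ k → 4 ≤ k → (f : Fin k → Fin n) → IsCycle Adj k f → HasChord Adj k f

  IsClique : Subset n → Set
  IsClique C = ∀ {x y} → x ∈ C → y ∈ C → x ≢ y → Adj x y

  IsMaxClique : Subset n → Set
  IsMaxClique C = IsClique C × (∀ D → IsClique D → C ⊆ D → D ⊆ C)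

  HasNonPublicVertex : Subset n → Set
  HasNonPublicVertex C = Σ[ v ∈ Fin n ] (v ∈ C × (∀ D → IsMaxClique D → v ∈ D → D ≡ C))

  -- G' = union of the already chosen maximal cliques Cs

  InV' : List (Subset n) → Fin n → Set
  InV' Cs x = Any (x ∈_) Cs

  E' : List (Subset n) → Fin n → Fin n → Set
  E' Cs x y = x ≢ y × Any (λ C → x ∈ C × y ∈ C) Cs

  ContainedIn' : List (Subset n) → Subset n → Set
  ContainedIn' Cs C = (∀ x → x ∈ C → InV' Cs x)
                    × (∀ x y → x ∈ C → y ∈ C → x ≢ y → E' Cs x y)

  Complete' : List (Subset n) → Set
  Complete' Cs = (∀ x → InV' Cs x) × (∀ x y → (Adj x y → E' Cs x y) × (E' Cs x y → Adj x y))

  IsMeet : List (Subset n) → Subset n → Subset n → Set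
  IsMeet Cs C S =
    InW S × CliqueW S × (∀ T → InW T → CliqueW T → S ⊆ T → T ⊆ S)
    where
    InW : Subset n → Set
    InW T = ∀ {x} → x ∈ T → x ∈ C × InV' Cs x
    CliqueW : Subset n → Set
    CliqueW T = ∀ {x y} → x ∈ T → y ∈ T → x ≢ y → E' Cs x y

  -- Partial runs of the construction.  A state consists of the list Cs of
  -- chosen maximal cliques (these are the vertices v_C of G_c, labelled by
  -- the clique C itself) and the edge relation Ec of G_c built so far
  -- (Ec A B means an edge v_A v_B was added).

  data Reach : List (Subset n) → (Subset n → Subset n → Set) → Set₁ where
    start : Reach [] (λ _ _ → ⊥)
    disjoint : ∀ {Cs Ec} C → Reach Cs Ec → IsMaxClique C → ¬ ContainedIn' Cs C →
      (∀ x → x ∈ C → ¬ InV' Cs x) →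
      Reach (C ∷ Cs) Ec
    meet : ∀ {Cs Ec} C → Reach Cs Ec → IsMaxClique C → ¬ ContainedIn' Cs C →
      (∃[ x ] (x ∈ C × InV' Cs x)) →
      (ch : Subset n → Subset n) →
      (∀ S → IsMeet Cs C S → (ch S ∈ₗ Cs) × (S ⊆ ch S)) →
      Reach (C ∷ Cs)
        (λ A B → Ec A B ⊎ (A ≡ C × Σ[ S ∈ Subset n ] (IsMeet Cs C S × ch S ≡ B)))

  InHtilde : List (Subset n) → (Subset n → Subset n → Set) → Set₁
  InHtilde Cs Ec = Reach Cs Ec × Complete' Cs

CGAdj : ∀ {n} (Cs : List (Subset n)) → (Subset n → Subset n → Set) →
        Fin (length Cs) → Fin (length Cs) → Set
CGAdj Cs Ec i j = Ec (lookup Cs i) (lookup Cs j) ⊎ Ec (lookup Cs j) (lookup Cs i)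

{-# OPTIONS --safe #-}
module Submission where

-- The cliques of a run that contain a given vertex v always span a connected
-- part of G_c, since a new clique through an old vertex v is attached to an old
-- clique containing v.  Hence a vertex of a leaf clique outside its unique
-- neighbour lies in no other chosen clique.  If G_c is acyclic, a new clique K
-- meets each component of G′ in a clique, so every cycle of length ≥ 4 using a
-- new edge has a third vertex in K, which yields a chord.
--
-- For chordal G, grow G′ so that it stays induced and convex: two vertices of
-- G′ joined by a walk outside G′ are adjacent.  Add a maximal clique through an
-- outside vertex h whose neighbourhood S in G′ is inclusion-maximal; convexity
-- makes S a clique, so S is the only meet and G_c gains a leaf.  Convexity
-- survives because in a chordal graph a vertex adjacent to both ends of an
-- induced path is adjacent to all of it.

open import Defs
open import Data.Nat using (ℕ; zero; suc; _+_; _∸_; _≤_; _<_; z≤n; s≤s; s≤s⁻¹; _<?_)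
import Data.Nat.Properties as ℕ
open import Data.Fin using (Fin; zero; suc; toℕ; fromℕ; fromℕ<; inject₁; _≟_)
open import Data.Fin.Properties using (toℕ-fromℕ; toℕ-fromℕ<; toℕ-inject₁; toℕ<n; toℕ-injective; suc-injective; any?; all?)
open import Data.Fin.Subset using (Subset; _∈_; _∉_; _⊆_; _⊃_; _∪_; ⁅_⁆)
open import Data.Fin.Subset.Properties
open import Data.Fin.Subset.Induction using (⊃-wellFounded)
open import Data.List using (List; []; _∷_; length; lookup)
open import Data.List.Relation.Unary.All as All using (All; []; _∷_)
open import Data.List.Relation.Unary.All.Properties using (anti-mono)
open import Data.List.Relation.Unary.AllPairs using ([]; _∷_)
open import Data.List.Relation.Unary.Any as Any using (Any; here; there; index)
open import Data.List.Relation.Unary.Any.Properties using (lookup-index)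
open import Data.List.Relation.Unary.Unique.Propositional using (Unique)
open import Data.List.Membership.Propositional using (lose) renaming (_∈_ to _∈ₗ_)
open import Data.List.Membership.Propositional.Properties using (∈-lookup)
open import Data.Product using (Σ-syntax; ∃-syntax; _×_; _,_; proj₁; proj₂)
open import Data.Sum as Sum using (_⊎_; inj₁; inj₂)
open import Data.Empty using (⊥; ⊥-elim)
open import Data.Unit using (⊤; tt)
open import Data.Vec using (tabulate)
open import Data.Vec.Properties using (lookup∘tabulate; []=⇒lookup; lookup⇒[]=)
open import Function using (_∘_; id)
open import Induction.WellFounded using (Acc; acc)
open import Relation.Nullary using (¬_; Dec; yes; no; does)
open import Relation.Nullary.Decidable using (¬?; _×-dec_; _⊎-dec_; _→-dec_; decidable-stable; dec-true)
open import Relation.Binary using (Decidable)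
open import Relation.Binary.PropositionalEquality using (_≡_; _≢_; refl; sym; trans; cong; subst; subst₂)
open import Relation.Binary.Construct.Closure.ReflexiveTransitive as Star using (Star; ε; _◅_; _◅◅_)

Unique⇒lookup-injective : ∀ {A : Set} {xs : List A} → Unique xs → ∀ {i j} → lookup xs i ≡ lookup xs j → i ≡ j
Unique⇒lookup-injective {xs = _ ∷ _}  _        {zero}  {zero}  _  = refl
Unique⇒lookup-injective {xs = _ ∷ xs} (x∉ ∷ _) {zero}  {suc j} eq = ⊥-elim (All.lookup x∉ (∈-lookup j) eq)
Unique⇒lookup-injective {xs = _ ∷ xs} (x∉ ∷ _) {suc i} {zero}  eq = ⊥-elim (All.lookup x∉ (∈-lookup i) (sym eq))
Unique⇒lookup-injective {xs = _ ∷ xs} (_ ∷ u)  {suc i} {suc j} eq = cong suc (Unique⇒lookup-injective u eq)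

-- Cyclic indices

next : ∀ {k} (i : Fin k) → ∃[ j ] Consec i j
next {suc k} i with suc (toℕ i) <? suc k
... | yes i<k = fromℕ< i<k , inj₁ (sym (toℕ-fromℕ< i<k))
... | no  i≮k = zero , inj₂ (ℕ.≤-antisym (toℕ<n i) (ℕ.≮⇒≥ i≮k) , refl)

previous : ∀ {k} (i : Fin k) → ∃[ j ] Consec j i
previous {suc k} zero    = fromℕ k , inj₂ (cong suc (toℕ-fromℕ k) , refl)
previous {suc k} (suc i) = inject₁ i , inj₁ (cong suc (toℕ-inject₁ i))

-- `Consec` unfolds to this at the underlying numbers, where its equations can be matched with
-- `refl`.
Next : ℕ → ℕ → ℕ → Set
Next k a b = (suc a ≡ b) ⊎ ((suc a ≡ k) × (b ≡ 0))

-- Returning after two cyclic steps would make `k` divide 2; in the next lemma, after three steps,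
-- `k` would divide 3.
Next-no-2-cycle : ∀ {k a b} → 3 ≤ k → Next k a b → Next k b a → ⊥
Next-no-2-cycle _ (inj₁ refl) (inj₁ ())
Next-no-2-cycle (s≤s (s≤s ())) (inj₁ refl) (inj₂ (refl , refl))
Next-no-2-cycle (s≤s (s≤s ())) (inj₂ (refl , refl)) (inj₁ refl)

Next-no-3-cycle : ∀ {k a b c} → 4 ≤ k → Next k a b → Next k b c → Next k c a → ⊥
Next-no-3-cycle _ (inj₁ refl) (inj₁ refl) (inj₁ ())
Next-no-3-cycle (s≤s (s≤s (s≤s ()))) (inj₁ refl) (inj₁ refl) (inj₂ (refl , refl))
Next-no-3-cycle (s≤s (s≤s (s≤s ()))) (inj₁ refl) (inj₂ (refl , refl)) (inj₁ refl)
Next-no-3-cycle _ (inj₁ refl) (inj₂ (refl , refl)) (inj₂ (() , _))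
Next-no-3-cycle (s≤s (s≤s (s≤s ()))) (inj₂ (refl , refl)) (inj₁ refl) (inj₁ refl)

Next-injectiveʳ : ∀ {k a b c} → b < k → c < k → Next k a b → Next k a c → b ≡ c
Next-injectiveʳ _   _   (inj₁ refl)       (inj₁ refl)       = refl
Next-injectiveʳ b<k _   (inj₁ refl)       (inj₂ (refl , _)) = ⊥-elim (ℕ.<-irrefl refl b<k)
Next-injectiveʳ _   c<k (inj₂ (refl , _)) (inj₁ refl)       = ⊥-elim (ℕ.<-irrefl refl c<k)
Next-injectiveʳ _   _   (inj₂ (_ , refl)) (inj₂ (_ , refl)) = refl

Next-injectiveˡ : ∀ {k a b c} → Next k a c → Next k b c → a ≡ b
Next-injectiveˡ (inj₁ refl)          (inj₁ refl)       = refl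
Next-injectiveˡ (inj₁ refl)          (inj₂ (_ , ()))
Next-injectiveˡ (inj₂ (_ , refl))    (inj₁ ())
Next-injectiveˡ (inj₂ (refl , refl)) (inj₂ (refl , _)) = refl

Consec-injectiveʳ : ∀ {k} {a b c : Fin k} → Consec a b → Consec a c → b ≡ c
Consec-injectiveʳ p q = toℕ-injective (Next-injectiveʳ (toℕ<n _) (toℕ<n _) p q)

Consec-injectiveˡ : ∀ {k} {a b c : Fin k} → Consec a c → Consec b c → a ≡ b
Consec-injectiveˡ p q = toℕ-injective (Next-injectiveˡ p q)

-- Paths

-- Vertices that are not neighbours on the path must be related by Sep:
-- Sep = _≢_ gives simple paths, Sep = "distinct and non-adjacent" induced ones.
module Paths {m} (R Sep : Fin m → Fin m → Set)
             (R⇒≢ : ∀ {x y} → R x y → x ≢ y) (Sep⇒≢ : ∀ {x y} → Sep x y → x ≢ y) where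

  -- The list holds the vertices after the start, so the whole vertex sequence of a path from `x` is
  -- `x ∷ xs`.
  data Path : Fin m → Fin m → List (Fin m) → Set where
    stop : ∀ {x} → Path x x []
    step : ∀ {x y z zs} → R x z → All (Sep x) zs → Path z y zs → Path x y (z ∷ zs)

  Path⇒Unique : ∀ {x y xs} → Path x y xs → Unique (x ∷ xs)
  Path⇒Unique stop         = [] ∷ []
  Path⇒Unique (step r s p) = (R⇒≢ r ∷ All.map Sep⇒≢ s) ∷ Path⇒Unique p

  lookup-step : ∀ {x y xs} → Path x y xs → (i j : Fin (suc (length xs))) → suc (toℕ i) ≡ toℕ j →
                R (lookup (x ∷ xs) i) (lookup (x ∷ xs) j)
  lookup-step stop         zero    zero          ()
  lookup-step (step r _ _) zero    zero          ()
  lookup-step (step r _ _) zero    (suc zero)    _  = r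
  lookup-step (step _ _ _) zero    (suc (suc _)) ()
  lookup-step (step _ _ p) (suc i) (suc j)       eq = lookup-step p i j (ℕ.suc-injective eq)

  lookup-last : ∀ {x y xs} → Path x y xs → (i : Fin (suc (length xs))) → toℕ i ≡ length xs →
                lookup (x ∷ xs) i ≡ y
  lookup-last stop         zero    _  = refl
  lookup-last (step _ _ _) zero    ()
  lookup-last (step _ _ p) (suc i) eq = lookup-last p i (ℕ.suc-injective eq)

  Path⇒Cycle : ∀ {t x y xs} → Path x y xs → All (t ≢_) (x ∷ xs) → R t x → R y t →
               IsCycle R (suc (suc (length xs))) (lookup (t ∷ x ∷ xs))
  Path⇒Cycle {t} {x} {y} {xs} p t∉p tx yt = Unique⇒lookup-injective (t∉p ∷ Path⇒Unique p) , edge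
    where
    edge : ∀ i j → Consec i j → R (lookup (t ∷ x ∷ xs) i) (lookup (t ∷ x ∷ xs) j)
    edge zero    zero          (inj₁ ())
    edge zero    (suc zero)    (inj₁ _)  = tx
    edge zero    (suc (suc _)) (inj₁ ())
    edge (suc i) (suc j)       (inj₁ eq) = lookup-step p i j (ℕ.suc-injective eq)
    edge zero    _             (inj₂ (() , _))
    edge (suc i) zero          (inj₂ (eq , _)) =
      subst (λ v → R v t) (sym (lookup-last p i (ℕ.suc-injective (ℕ.suc-injective eq)))) yt

  module _ (near : ∀ x w → (x ≡ w ⊎ R x w) ⊎ Sep x w) {Q : Fin m → Set} where

    -- The tail is searched first, so `x` is joined to the last vertex of the path that `near`
    -- reports as equal or related to it. All later vertices are then `Sep` from `x`, as `step`
    -- requires.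
    attach : ∀ x {y z zs} → Path z y zs → Q z → All Q zs →
             (∃[ xs ] (Path x y xs × All Q xs)) ⊎ All (Sep x) (z ∷ zs)
    attach x {z = z} stop qz [] with near x z
    ... | inj₁ (inj₁ refl) = inj₁ ([] , stop , [])
    ... | inj₁ (inj₂ r)    = inj₁ (_ , step r [] stop , qz ∷ [])
    ... | inj₂ s           = inj₂ (s ∷ [])
    attach x {z = z} (step r s p) qz (qz′ ∷ qzs) with attach x p qz′ qzs | near x z
    ... | inj₁ found | _                = inj₁ found
    ... | inj₂ sep   | inj₁ (inj₁ refl) = inj₁ (_ , step r s p , qz′ ∷ qzs)
    ... | inj₂ sep   | inj₁ (inj₂ r′)   = inj₁ (_ , step r′ sep (step r s p) , qz ∷ qz′ ∷ qzs)
    ... | inj₂ sep   | inj₂ s′          = inj₂ (s′ ∷ sep)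

    Star⇒Path : ∀ {x y} → Star (λ a b → R a b × Q b) x y → ∃[ xs ] (Path x y xs × All Q xs)
    Star⇒Path ε = [] , stop , []
    Star⇒Path {x} ((r , q) ◅ w) with Star⇒Path w
    ... | zs , p , qs with attach x p q qs
    ...   | inj₁ found     = found
    -- `R` and `Sep` need not exclude each other: with `Sep = _≢_`, `near` may answer `Sep` even at
    -- an edge. The first edge of the walk is then kept.
    ...   | inj₂ (_ ∷ sep) = _ , step r sep p , q ∷ qs

-- Maximal cliques

module _ {n} {P : Fin n → Set} (P? : ∀ x → Dec (P x))
         {R : Fin n → Fin n → Set} (R? : Decidable R) (R-sym : ∀ {x y} → R x y → R y x) where

  private
    Inside Clique : Subset n → Set
    Inside T = ∀ {x} → x ∈ T → P x
    Clique T = ∀ {x y} → x ∈ T → y ∈ T → x ≢ y → R x y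

  -- Vertices related to everything chosen so far are added while one exists, by induction on
  -- growing subsets. Abstract `P` and `R` let this produce both maximal cliques of G and meets of a
  -- clique with G′.
  extend-to-maximal : ∀ T → Inside T → Clique T →
    Σ[ S ∈ Subset n ] (T ⊆ S × Inside S × Clique S × (∀ D → Inside D → Clique D → S ⊆ D → D ⊆ S))
  extend-to-maximal T = go T (⊃-wellFounded T)
    where
    go : ∀ T → Acc _⊃_ T → Inside T → Clique T →
      Σ[ S ∈ Subset n ] (T ⊆ S × Inside S × Clique S × (∀ D → Inside D → Clique D → S ⊆ D → D ⊆ S))
    go T (acc rec) inside clique
      with any? (λ v → P? v ×-dec ¬? (v ∈? T) ×-dec all? (λ x → (x ∈? T) →-dec R? v x))
    ... | no none = T , ⊆-refl , inside , clique ,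
          λ D iD cD T⊆D {v} v∈D → decidable-stable (v ∈? T) λ v∉T →
            none (v , iD v∈D , v∉T , λ x x∈T → cD v∈D (T⊆D x∈T) λ { refl → v∉T x∈T })
    ... | yes (v , Pv , v∉T , adj) =
      let S , T′⊆S , rest = go (⁅ v ⁆ ∪ T)
                               (rec (q⊆p∪q ⁅ v ⁆ T , v , p⊆p∪q T (x∈⁅x⁆ v) , v∉T))
                               inside′ clique′
      in S , ⊆-trans (q⊆p∪q ⁅ v ⁆ T) T′⊆S , rest
      where
      inside′ : Inside (⁅ v ⁆ ∪ T)
      inside′ x∈ with x∈p∪q⁻ ⁅ v ⁆ T x∈
      ... | inj₁ x∈v = subst P (sym (x∈⁅y⁆⇒x≡y v x∈v)) Pv
      ... | inj₂ x∈T = inside x∈T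
      clique′ : Clique (⁅ v ⁆ ∪ T)
      clique′ {x} {y} x∈ y∈ x≢y with x∈p∪q⁻ ⁅ v ⁆ T x∈ | x∈p∪q⁻ ⁅ v ⁆ T y∈
      ... | inj₁ x∈v | inj₁ y∈v = ⊥-elim (x≢y (trans (x∈⁅y⁆⇒x≡y v x∈v) (sym (x∈⁅y⁆⇒x≡y v y∈v))))
      ... | inj₁ x∈v | inj₂ y∈T = subst (λ u → R u y) (sym (x∈⁅y⁆⇒x≡y v x∈v)) (adj y y∈T)
      ... | inj₂ x∈T | inj₁ y∈v = subst (R x) (sym (x∈⁅y⁆⇒x≡y v y∈v)) (R-sym (adj x x∈T))
      ... | inj₂ x∈T | inj₂ y∈T = clique x∈T y∈T x≢y

-- Walks along a cycle

consec? : ∀ {k} (i j : Fin k) → Dec (Consec i j)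
consec? {k} i j = (suc (toℕ i) ℕ.≟ toℕ j) ⊎-dec ((suc (toℕ i) ℕ.≟ k) ×-dec (toℕ j ℕ.≟ 0))

module _ {k} {T : Fin k → Fin k → Set} where

  -- The distance `d` drives the recursion. `T` is asked only between `a` and `b`, so that callers
  -- can leave out a forbidden index.
  ascend : ∀ d (a b : Fin k) → d + toℕ a ≡ toℕ b →
           (∀ c c′ → suc (toℕ c) ≡ toℕ c′ → toℕ a ≤ toℕ c → toℕ c < toℕ b → T c c′) → Star T a b
  ascend zero    a b eq _ rewrite toℕ-injective eq = ε
  ascend (suc d) a b eq t = t a a′ (sym a′≡) ℕ.≤-refl a<b ◅ ascend d a′ b eq′ t′
    where
    a<b : toℕ a < toℕ b
    a<b = subst (toℕ a <_) eq (s≤s (ℕ.m≤n+m (toℕ a) d))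
    a′ = fromℕ< (ℕ.≤-<-trans a<b (toℕ<n b))
    a′≡ : toℕ a′ ≡ suc (toℕ a)
    a′≡ = toℕ-fromℕ< (ℕ.≤-<-trans a<b (toℕ<n b))
    eq′ : d + toℕ a′ ≡ toℕ b
    eq′ = trans (cong (d +_) a′≡) (trans (ℕ.+-suc d (toℕ a)) eq)
    t′ : ∀ c c′ → suc (toℕ c) ≡ toℕ c′ → toℕ a′ ≤ toℕ c → toℕ c < toℕ b → T c c′
    t′ c c′ c≡ a′≤c = t c c′ c≡ (ℕ.≤-trans (ℕ.n≤1+n _) (subst (_≤ toℕ c) a′≡ a′≤c))

-- Deleting the arc from `i` to `j` opens the cycle into a path. If `i` is the last index, this is
-- one ascent from zero; otherwise it climbs from `j` to the last index, wraps to zero and climbs to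
-- `i`.
go-around : ∀ {k} {T : Fin k → Fin k → Set} {i j} → Consec i j →
            (∀ c c′ → Consec c c′ → c ≢ i → T c c′) → Star T j i
go-around {suc k} {T} {i} {j} (inj₂ (_ , j≡0)) t =
  ascend (toℕ i) j i (trans (cong (toℕ i +_) j≡0) (ℕ.+-identityʳ _))
    λ c c′ c≡ _ c<i → t c c′ (inj₁ c≡) λ { refl → ℕ.<-irrefl refl c<i }
go-around {suc k} {T} {i} {j} (inj₁ i+1≡j) t =
  ascend (k ∸ toℕ j) j last (trans (ℕ.m∸n+n≡m (s≤s⁻¹ (toℕ<n j))) (sym (toℕ-fromℕ k)))
    (λ c c′ c≡ j≤c _ → t c c′ (inj₁ c≡) λ { refl → ℕ.<-irrefl refl (subst (_≤ toℕ c) (sym i+1≡j) j≤c) })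
  ◅◅ t last zero (inj₂ (cong suc (toℕ-fromℕ k) , refl)) last≢i
  ◅ ascend (toℕ i) zero i (ℕ.+-identityʳ _)
    λ c c′ c≡ _ c<i → t c c′ (inj₁ c≡) λ { refl → ℕ.<-irrefl refl c<i }
  where
  last = fromℕ k
  last≢i : last ≢ i
  last≢i refl = ℕ.<-irrefl (trans (sym i+1≡j) (cong suc (toℕ-fromℕ k))) (toℕ<n j)

Acyclic : ∀ {m} → (Fin m → Fin m → Set) → Set
Acyclic {m} R = ∀ k → 3 ≤ k → (f : Fin k → Fin m) → ¬ IsCycle R k f

-- Clique graphs of an arbitrary graph

module CliqueGraph {n} (G : Graph n) where
  open Graph G renaming (sym to Adj-sym; irrefl to Adj-irrefl; dec to adj?) public

  private variable
    Cs : List (Subset n)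
    Ec : Subset n → Subset n → Set

  inV? : ∀ Cs x → Dec (InV' G Cs x)
  inV? Cs x = Any.any? (x ∈?_) Cs

  E'? : ∀ Cs → Decidable (E' G Cs)
  E'? Cs x y = ¬? (x ≟ y) ×-dec Any.any? (λ C → (x ∈? C) ×-dec (y ∈? C)) Cs

  E'-sym : ∀ {x y} → E' G Cs x y → E' G Cs y x
  E'-sym (x≢y , any) = x≢y ∘ sym , Any.map (λ (a , b) → b , a) any

  E'⇒InV'ˡ : ∀ {x y} → E' G Cs x y → InV' G Cs x
  E'⇒InV'ˡ (_ , any) = Any.map proj₁ any

  E'-there : ∀ {K x y} → E' G Cs x y → E' G (K ∷ Cs) x y
  E'-there (x≢y , any) = x≢y , there any

  extend-to-MaxClique : ∀ T → IsClique G T → Σ[ C ∈ Subset n ] (T ⊆ C × IsMaxClique G C)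
  extend-to-MaxClique T cT with extend-to-maximal {P = λ _ → ⊤} (λ _ → yes tt) adj? Adj-sym T (λ _ → tt) cT
  ... | C , T⊆C , _ , cC , max = C , T⊆C , cC , λ D → max D (λ _ → tt)

  Meet-∋ : ∀ {Cs} C {v} → v ∈ C → InV' G Cs v → Σ[ S ∈ Subset n ] (IsMeet G Cs C S × v ∈ S)
  Meet-∋ {Cs} C {v} v∈C v∈V
    with extend-to-maximal {P = λ x → x ∈ C × InV' G Cs x} (λ x → (x ∈? C) ×-dec inV? Cs x)
           (E'? Cs) E'-sym ⁅ v ⁆
           (λ x∈ → subst (λ x → x ∈ C × InV' G Cs x) (sym (x∈⁅y⁆⇒x≡y v x∈)) (v∈C , v∈V))
           (λ x∈ y∈ x≢y → ⊥-elim (x≢y (trans (x∈⁅y⁆⇒x≡y v x∈) (sym (x∈⁅y⁆⇒x≡y v y∈)))))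
  ... | S , v∈S , inS , cS , max = S , (inS , cS , max) , v∈S (x∈⁅x⁆ v)

  MaxClique-⊆⇒≡ : ∀ {A B} → IsMaxClique G A → IsMaxClique G B → A ⊆ B → A ≡ B
  MaxClique-⊆⇒≡ (_ , maxA) (cB , _) A⊆B = ⊆-antisym A⊆B (maxA _ cB A⊆B)

  fresh⇒∉ : ∀ {C} → ¬ ContainedIn' G Cs C → ¬ (C ∈ₗ Cs)
  fresh⇒∉ fresh C∈ = fresh ((λ x x∈C → lose C∈ x∈C) , λ x y x∈C y∈C x≢y → x≢y , lose C∈ (x∈C , y∈C))

  Reach⇒MaxCliques : Reach G Cs Ec → All (IsMaxClique G) Cs
  Reach⇒MaxCliques start                    = []
  Reach⇒MaxCliques (disjoint _ r max _ _)   = max ∷ Reach⇒MaxCliques r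
  Reach⇒MaxCliques (meet _ r max _ _ _ _)   = max ∷ Reach⇒MaxCliques r

  Reach⇒Unique : Reach G Cs Ec → Unique Cs
  Reach⇒Unique start = []
  Reach⇒Unique (disjoint _ r _ fresh _) =
    All.tabulate (λ { D∈ refl → fresh⇒∉ fresh D∈ }) ∷ Reach⇒Unique r
  Reach⇒Unique (meet _ r _ fresh _ _ _) =
    All.tabulate (λ { D∈ refl → fresh⇒∉ fresh D∈ }) ∷ Reach⇒Unique r

  Ec-members : Reach G Cs Ec → ∀ {A B} → Ec A B → A ∈ₗ Cs × B ∈ₗ Cs × A ≢ B
  Ec-members (disjoint _ r _ _ _) e with Ec-members r e
  ... | A∈ , B∈ , A≢B = there A∈ , there B∈ , A≢B
  Ec-members (meet _ r _ _ _ _ _) (inj₁ e) with Ec-members r e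
  ... | A∈ , B∈ , A≢B = there A∈ , there B∈ , A≢B
  Ec-members (meet C r _ fresh _ ch choice) (inj₂ (refl , S , isMeet , refl)) =
    let B∈ = proj₁ (choice S isMeet)
    in here refl , there B∈ , λ eq → fresh⇒∉ fresh (subst (_∈ₗ _) (sym eq) B∈)

  CGAdj⇒lookup-≢ : Reach G Cs Ec → ∀ {i j} → CGAdj Cs Ec i j → lookup Cs i ≢ lookup Cs j
  CGAdj⇒lookup-≢ r (inj₁ e) = proj₂ (proj₂ (Ec-members r e))
  CGAdj⇒lookup-≢ r (inj₂ e) = proj₂ (proj₂ (Ec-members r e)) ∘ sym

  CGAdj⇒≢ : Reach G Cs Ec → ∀ {i j} → CGAdj Cs Ec i j → i ≢ j
  CGAdj⇒≢ r e refl = CGAdj⇒lookup-≢ r e refl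

  MeetEdge : List (Subset n) → Subset n → (Subset n → Subset n) → Subset n → Subset n → Set
  MeetEdge Cs C ch A B = A ≡ C × Σ[ S ∈ Subset n ] (IsMeet G Cs C S × ch S ≡ B)

  -- The meet obtained by growing the singleton of `v` lies in the old clique chosen for it, so that
  -- clique contains `v` as well.
  attachment : ∀ {Cs C ch} {v} → (∀ S → IsMeet G Cs C S → (ch S ∈ₗ Cs) × (S ⊆ ch S)) →
               v ∈ C → InV' G Cs v → ∃[ i ] (MeetEdge Cs C ch C (lookup Cs i) × v ∈ lookup Cs i)
  attachment {C = C} {v = v} choice v∈C v∈V =
    let S , isMeet , v∈S = Meet-∋ C v∈C v∈V
        ch∈ , S⊆ch       = choice S isMeet
    in index ch∈ , (refl , S , isMeet , lookup-index ch∈) , subst (v ∈_) (lookup-index ch∈) (S⊆ch v∈S)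

  -- Cliques through a vertex, and leaves

  Through : ∀ Cs → (Subset n → Subset n → Set) → Fin n → Fin (length Cs) → Fin (length Cs) → Set
  Through Cs Ec v a b = CGAdj Cs Ec a b × v ∈ lookup Cs a × v ∈ lookup Cs b

  cliques-∋-connected : Reach G Cs Ec → ∀ {v} i j → v ∈ lookup Cs i → v ∈ lookup Cs j →
                        Star (Through Cs Ec v) i j
  cliques-∋-connected (disjoint _ _ _ _ _) zero zero _ _ = ε
  cliques-∋-connected (disjoint _ _ _ _ apart) zero (suc j) vi vj = ⊥-elim (apart _ vi (lose (∈-lookup j) vj))
  cliques-∋-connected (disjoint _ _ _ _ apart) (suc i) zero vi vj = ⊥-elim (apart _ vj (lose (∈-lookup i) vi))
  cliques-∋-connected (disjoint _ r _ _ _) (suc i) (suc j) vi vj =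
    Star.gmap suc id (cliques-∋-connected r i j vi vj)
  cliques-∋-connected (meet {Cs} {Ec} C r _ _ _ ch choice) {v} = connected
    where
    Through′ = Through (C ∷ Cs) (λ A B → Ec A B ⊎ MeetEdge Cs C ch A B) v
    old : ∀ i j → v ∈ lookup Cs i → v ∈ lookup Cs j → Star Through′ (suc i) (suc j)
    old i j vi vj = Star.gmap suc (λ (e , p) → Sum.map inj₁ inj₁ e , p) (cliques-∋-connected r i j vi vj)
    new : ∀ j → v ∈ C → v ∈ lookup Cs j → Star Through′ zero (suc j)
    new j vC vj with attachment choice vC (lose (∈-lookup j) vj)
    ... | i , e , vi = (inj₁ (inj₂ e) , vC , vi) ◅ old i j vi vj
    connected : ∀ i j → v ∈ lookup (C ∷ Cs) i → v ∈ lookup (C ∷ Cs) j → Star Through′ i j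
    connected zero    zero    _  _  = ε
    connected zero    (suc j) vi vj = new j vi vj
    connected (suc i) zero    vi vj = Star.reverse (λ (e , va , vb) → Sum.swap e , vb , va) (new i vj vi)
    connected (suc i) (suc j) vi vj = old i j vi vj

  -- Distinct maximal cliques are incomparable, so the leaf clique has a vertex `v` outside its
  -- neighbour. This `v` is the witness.
  leaf⇒HasNonPublicVertex : InHtilde G Cs Ec → ∀ i → IsLeaf (CGAdj Cs Ec) i →
                            HasNonPublicVertex G (lookup Cs i)
  leaf⇒HasNonPublicVertex {Cs} {Ec} (r , _ , adj⇔E') i (j , e , only)
    with any? (λ v → (v ∈? lookup Cs i) ×-dec ¬? (v ∈? lookup Cs j))
  ... | no none = ⊥-elim (CGAdj⇒lookup-≢ r e (MaxClique-⊆⇒≡ (maximal i) (maximal j) Ci⊆Cj))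
    where
    maximal : ∀ i → IsMaxClique G (lookup Cs i)
    maximal i = All.lookup (Reach⇒MaxCliques r) (∈-lookup i)
    Ci⊆Cj : lookup Cs i ⊆ lookup Cs j
    Ci⊆Cj {v} v∈ = decidable-stable (v ∈? lookup Cs j) λ v∉ → none (v , v∈ , v∉)
  ... | yes (v , v∈i , v∉j) = v , v∈i , λ D maxD v∈D →
          MaxClique-⊆⇒≡ maxD (All.lookup (Reach⇒MaxCliques r) (∈-lookup i)) (D⊆ maxD v∈D)
    where
    -- The first step of a nontrivial walk from the leaf goes to `j`, whose clique misses `v`.
    unique : ∀ {a} → Star (Through Cs Ec v) i a → i ≡ a
    unique ε = refl
    unique ((e′ , _ , v∈b) ◅ _) = ⊥-elim (v∉j (subst (λ b → v ∈ lookup Cs b) (only _ e′) v∈b))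
    -- `D` need not be known to be a chosen clique. Each of its edges `vy` is covered by a chosen
    -- clique through `v`, and the leaf clique is the only one.
    D⊆ : ∀ {D} → IsMaxClique G D → v ∈ D → D ⊆ lookup Cs i
    D⊆ (cD , _) v∈D {y} y∈D with v ≟ y
    ... | yes refl = v∈i
    ... | no  v≢y  =
      let vy      = proj₂ (proj₁ (adj⇔E' v y) (cD v∈D y∈D v≢y))
          va , ya = lookup-index vy
      in subst (λ a → y ∈ lookup Cs a) (sym (unique (cliques-∋-connected r i (index vy) v∈i va))) ya

  -- Acyclic clique graphs force chordality

  CycleChord : (Fin n → Fin n → Set) → Set
  CycleChord R = ∀ k → 4 ≤ k → (f : Fin k → Fin n) → IsCycle R k f → HasChord R k f

  -- The hypothesis says that `K` meets each component of G′ in a clique of G′. A cycle of old edges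
  -- has an old chord. If a cycle has a new edge and no third vertex in `K`, its other edges join
  -- the ends of that edge inside G′, so the edge was old after all.
  add-clique-chordal : ∀ {Cs} K →
    (∀ {x y} → x ∈ K → y ∈ K → x ≢ y → Star (E' G Cs) y x → E' G Cs x y) →
    CycleChord (E' G Cs) → CycleChord (E' G (K ∷ Cs))
  add-clique-chordal {Cs} K separated chordal k 4≤k f (inj , edge)
    with any? (λ i → any? (λ j → consec? i j ×-dec ¬? (E'? Cs (f i) (f j))))
  ... | no none =
    let i , j , i≢j , ¬ij , ¬ji , e = chordal k 4≤k f (inj , λ i j c →
          decidable-stable (E'? Cs (f i) (f j)) λ ¬e → none (i , j , c , ¬e))
    in i , j , i≢j , ¬ij , ¬ji , E'-there e
  ... | yes (i , j , ij , ¬e) with edge i j ij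
  ...   | x≢y , there any = ⊥-elim (¬e (x≢y , any))
  ...   | x≢y , here (x∈K , y∈K)
    with any? (λ l → ¬? (l ≟ i) ×-dec ¬? (l ≟ j) ×-dec (f l ∈? K))
  ...     | yes (l , l≢i , l≢j , l∈K) = chord
    where
    chord : HasChord (E' G (K ∷ Cs)) k f
    -- `l` is joined in `K` to both ends of the edge, but on a cycle of length at least 4 it is next
    -- to at most one of them.
    chord with consec? l i
    ... | no ¬li = l , i , l≢i , ¬li , (λ il → l≢j (Consec-injectiveʳ il ij)) ,
                   (l≢i ∘ inj) , here (l∈K , x∈K)
    ... | yes li = l , j , l≢j , (λ lj → l≢i (Consec-injectiveˡ lj ij)) ,
                   (λ jl → Next-no-3-cycle 4≤k li ij jl) , (l≢j ∘ inj) , here (l∈K , y∈K)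
  ...     | no none = ⊥-elim (¬e (separated x∈K y∈K x≢y (Star.gmap f id (go-around ij old))))
    where
    in-K : ∀ {c} → f c ∈ K → c ≢ i → c ≡ j
    in-K {c} c∈K c≢i = decidable-stable (c ≟ j) λ c≢j → none (c , c≢i , c≢j , c∈K)
    -- A cycle edge inside `K` has both ends among `i` and `j`. Starting at `c ≢ i`, it would run
    -- from `j` back to `i` or be a loop.
    old : ∀ c c′ → Consec c c′ → c ≢ i → E' G Cs (f c) (f c′)
    old c c′ cc′ c≢i with edge c c′ cc′
    ... | ≢ , there any = ≢ , any
    ... | ≢ , here (c∈K , c′∈K) with c′ ≟ i
    ...   | yes refl = ⊥-elim (Next-no-2-cycle (ℕ.≤-trans (ℕ.n≤1+n 3) 4≤k) ij
                                 (subst (λ a → Consec a c′) (in-K c∈K c≢i) cc′))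
    ...   | no c′≢i  = ⊥-elim (≢ (cong f (trans (in-K c∈K c≢i) (sym (in-K c′∈K c′≢i)))))

  -- Cliques covering consecutive edges of the walk share a vertex, and the cliques through that
  -- vertex are connected; these pieces are concatenated.
  walk-lift : Reach G Cs Ec → ∀ {x y a b} → Star (E' G Cs) x y →
              x ∈ lookup Cs a → y ∈ lookup Cs b → Star (CGAdj Cs Ec) a b
  walk-lift r {a = a} {b} ε xa yb = Star.map proj₁ (cliques-∋-connected r a b xa yb)
  walk-lift r {a = a} ((_ , any) ◅ w) xa yb =
    let xc , zc = lookup-index any
    in Star.map proj₁ (cliques-∋-connected r a (index any) xa xc) ◅◅ walk-lift r w zc yb

  -- Induction along the run: each earlier clique graph embeds in the later one and inherits
  -- acyclicity, leaving only the hypothesis of `add-clique-chordal` for the new clique.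
  Acyclic⇒chordal : Reach G Cs Ec → Acyclic (CGAdj Cs Ec) → CycleChord (E' G Cs)
  Acyclic⇒chordal start _ (suc k) _ f (_ , edge) with edge zero _ (proj₂ (next zero))
  ... | _ , ()
  Acyclic⇒chordal (disjoint {Cs} C r _ _ apart) acyclic =
    add-clique-chordal C separated
      (Acyclic⇒chordal r λ k 3≤k f (inj , edge) → acyclic k 3≤k (suc ∘ f) (inj ∘ suc-injective , edge))
    where
    separated : ∀ {x y} → x ∈ C → y ∈ C → x ≢ y → Star (E' G Cs) y x → E' G Cs x y
    separated _ _   x≢y ε       = ⊥-elim (x≢y refl)
    separated _ y∈C _   (e ◅ _) = ⊥-elim (apart _ y∈C (E'⇒InV'ˡ e))
  Acyclic⇒chordal r′@(meet {Cs} {Ec} C r _ _ _ ch choice) acyclic =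
    add-clique-chordal C separated
      (Acyclic⇒chordal r λ k 3≤k f (inj , edge) → acyclic k 3≤k (suc ∘ f)
        (inj ∘ suc-injective , λ i j c → Sum.map inj₁ inj₁ (edge i j c)))
    where
    R′ = CGAdj (C ∷ Cs) (λ A B → Ec A B ⊎ MeetEdge Cs C ch A B)
    open Paths R′ _≢_ (CGAdj⇒≢ r′) id
    near : ∀ x w → (x ≡ w ⊎ R′ x w) ⊎ x ≢ w
    near x w with x ≟ w
    ... | yes x≡w = inj₁ (inj₁ x≡w)
    ... | no  x≢w = inj₂ x≢w

    -- The old walk is thinned to a simple path; the predicate `zero ≢_` records that it avoids the
    -- new vertex, which then closes it to a cycle.
    closes-cycle : ∀ {a b} → a ≢ b → Star (CGAdj Cs Ec) a b → R′ zero (suc a) → R′ (suc b) zero → ⊥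
    closes-cycle {a} {b} a≢b w e e′ with Star⇒Path near {Q = zero ≢_}
      (Star.gmap suc (λ t → Sum.map inj₁ inj₁ t , λ ()) w)
    ... | _ , stop       , _ = a≢b refl
    ... | _ , step t s p , q =
      acyclic _ (s≤s (s≤s (s≤s z≤n))) _ (Path⇒Cycle (step t s p) ((λ ()) ∷ q) e e′)

    -- `C` is attached to old cliques containing `x` and `y`, and the walk connects these in the old
    -- clique graph. Acyclicity makes them equal, so one old clique contains both vertices.
    separated : ∀ {x y} → x ∈ C → y ∈ C → x ≢ y → Star (E' G Cs) y x → E' G Cs x y
    separated _ _ x≢y ε = ⊥-elim (x≢y refl)
    -- The first edge of the reversed walk shows that `x` is an old vertex too.
    separated {x} {y} x∈C y∈C x≢y w@(e ◅ _) with Star.reverse E'-sym w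
    ... | ε = ⊥-elim (x≢y refl)
    ... | e′ ◅ _ with attachment choice x∈C (E'⇒InV'ˡ e′) | attachment choice y∈C (E'⇒InV'ˡ e)
    ...   | a , ea , xa | b , eb , yb with b ≟ a
    ...     | yes refl = x≢y , lose (∈-lookup a) (xa , yb)
    ...     | no b≢a   = ⊥-elim (closes-cycle b≢a (walk-lift r w yb xa) (inj₁ (inj₂ eb)) (inj₂ (inj₂ ea)))

  Acyclic⇒Chordal : InHtilde G Cs Ec → Acyclic (CGAdj Cs Ec) → Chordal G
  Acyclic⇒Chordal (r , _ , adj⇔E') acyclic k 4≤k f (inj , edge) =
    let i , j , i≢j , ¬ij , ¬ji , e = Acyclic⇒chordal r acyclic k 4≤k f
          (inj , λ i j c → proj₁ (adj⇔E' _ _) (edge i j c))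
    in i , j , i≢j , ¬ij , ¬ji , proj₂ (adj⇔E' _ _) e


-- Trees extended by a leaf

attach-leaf : ∀ {m} {R : Fin m → Fin m → Set} {R′ : Fin (suc m) → Fin (suc m) → Set} d →
  (∀ {i j} → R i j → R′ (suc i) (suc j)) → (∀ {i j} → R′ (suc i) (suc j) → R i j) →
  (∀ {x y} → R′ x y → R′ y x) → R′ zero (suc d) → (∀ {x} → R′ zero x → x ≡ suc d) →
  IsTree R → IsTree R′
attach-leaf {m} {R} {R′} d up down R′-sym leaf only ((_ , connected) , acyclic) =
  (zero , connected′) , acyclic′
  where
  connected′ : ∀ x y → Star R′ x y
  connected′ zero    zero    = ε
  connected′ zero    (suc y) = leaf ◅ Star.gmap suc up (connected d y)
  connected′ (suc x) zero    = Star.gmap suc up (connected x d) ◅◅ (R′-sym leaf ◅ ε)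
  connected′ (suc x) (suc y) = Star.gmap suc up (connected x y)

  pred-off-zero : (x : Fin (suc m)) → x ≢ zero → Σ[ y ∈ Fin m ] x ≡ suc y
  pred-off-zero zero    x≢0 = ⊥-elim (x≢0 refl)
  pred-off-zero (suc y) _   = y , refl

  -- On a cycle through the leaf, its predecessor and successor would both be `suc d`, hence the
  -- same index. Any other cycle lies in the old tree.
  acyclic′ : Acyclic R′
  acyclic′ k 3≤k f (inj , edge) with any? (λ i → f i ≟ zero)
  ... | yes (i , fi≡0) =
    let p , pi = previous i
        s , is = next i
        fp≡ = only (subst (λ x → R′ x (f p)) fi≡0 (R′-sym (edge p i pi)))
        fs≡ = only (subst (λ x → R′ x (f s)) fi≡0 (edge i s is))
    in Next-no-2-cycle 3≤k pi (subst (Consec i) (inj (trans fs≡ (sym fp≡))) is)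
  ... | no none = acyclic k 3≤k g
        ( (λ {i} {j} eq → inj (trans (f≡ i) (trans (cong suc eq) (sym (f≡ j)))))
        , λ i j c → down (subst₂ R′ (f≡ i) (f≡ j) (edge i j c)))
    where
    g : Fin k → Fin m
    g i = proj₁ (pred-off-zero (f i) λ eq → none (i , eq))
    f≡ : ∀ i → f i ≡ suc (g i)
    f≡ i = proj₂ (pred-off-zero (f i) λ eq → none (i , eq))

module _ {n} {P : Fin n → Set} (P? : ∀ x → Dec (P x)) where

  fromDec : Subset n
  fromDec = tabulate (does ∘ P?)

  ∈-fromDec⁺ : ∀ {x} → P x → x ∈ fromDec
  ∈-fromDec⁺ {x} px = lookup⇒[]= x fromDec (trans (lookup∘tabulate _ x) (dec-true (P? x) px))

  ∈-fromDec⁻ : ∀ {x} → x ∈ fromDec → P x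
  ∈-fromDec⁻ {x} x∈ with P? x | trans (sym (lookup∘tabulate (does ∘ P?) x)) ([]=⇒lookup x∈)
  ... | yes px | _ = px

-- Chordal graphs

module ChordalGraph {n} (G : Graph n) (chordal : Chordal G) where
  open CliqueGraph G

  Apart : Fin n → Fin n → Set
  Apart x y = x ≢ y × ¬ Adj x y

  Adj⇒≢ : ∀ {x y} → Adj x y → x ≢ y
  Adj⇒≢ a refl = Adj-irrefl a

  open Paths Adj Apart Adj⇒≢ proj₁

  near : ∀ x w → (x ≡ w ⊎ Adj x w) ⊎ Apart x w
  near x w with x ≟ w | adj? x w
  ... | yes x≡w | _      = inj₁ (inj₁ x≡w)
  ... | no  _   | yes xw = inj₁ (inj₂ xw)
  ... | no  x≢w | no ¬xw = inj₂ (x≢w , ¬xw)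

  induced : ∀ {x y xs} → Path x y xs → (i j : Fin (suc (length xs))) →
            Adj (lookup (x ∷ xs) i) (lookup (x ∷ xs) j) → suc (toℕ i) ≡ toℕ j ⊎ suc (toℕ j) ≡ toℕ i
  induced stop         zero          zero          e = ⊥-elim (Adj-irrefl e)
  induced (step _ _ _) zero          zero          e = ⊥-elim (Adj-irrefl e)
  induced (step _ _ _) zero          (suc zero)    _ = inj₁ refl
  induced (step _ s _) zero          (suc (suc j)) e = ⊥-elim (proj₂ (All.lookup s (∈-lookup j)) e)
  induced (step _ _ _) (suc zero)    zero          _ = inj₂ refl
  induced (step _ s _) (suc (suc i)) zero          e = ⊥-elim (proj₂ (All.lookup s (∈-lookup i)) (Adj-sym e))
  induced (step _ _ p) (suc i)       (suc j)       e = Sum.map (cong suc) (cong suc) (induced p i j e)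

  -- Closing the path through `t` gives a cycle of length at least 4. It has no chord: the path is
  -- induced, and `t` sees only its two ends.
  no-hole : ∀ {t x y xs} → Path x y xs → 2 ≤ length xs → All (t ≢_) (x ∷ xs) →
            Adj t x → Adj t y → All (λ w → Adj t w → w ≡ y) xs → ⊥
  no-hole {t} {x} {y} {xs} p 2≤ t∉p tx ty only =
    let i , j , i≢j , ¬ij , ¬ji , e = chordal _ (s≤s (s≤s 2≤)) _ (Path⇒Cycle p t∉p tx (Adj-sym ty))
    in no-chord i j i≢j ¬ij ¬ji e
    where
    last : ∀ j → lookup xs j ≡ y → suc (toℕ j) ≡ length xs
    last j eq = trans (cong toℕ (Unique⇒lookup-injective (Path⇒Unique p) {suc j} {fromℕ (length xs)}
                  (trans eq (sym (lookup-last p _ (toℕ-fromℕ _)))))) (toℕ-fromℕ _)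
    no-chord-at-t : ∀ j → ¬ Consec {suc (suc (length xs))} zero (suc j) →
                    ¬ Consec {suc (suc (length xs))} (suc j) zero → ¬ Adj t (lookup (x ∷ xs) j)
    no-chord-at-t zero    ¬0j _   e = ¬0j (inj₁ refl)
    no-chord-at-t (suc j) _   ¬j0 e =
      ¬j0 (inj₂ (cong suc (cong suc (last j (All.lookup only (∈-lookup j) e))) , refl))
    no-chord : ∀ i j → i ≢ j → ¬ Consec i j → ¬ Consec j i →
               ¬ Adj (lookup (t ∷ x ∷ xs) i) (lookup (t ∷ x ∷ xs) j)
    no-chord zero    zero    i≢j _   _   _ = i≢j refl
    no-chord zero    (suc j) _   ¬ij ¬ji e = no-chord-at-t j ¬ij ¬ji e
    no-chord (suc i) zero    _   ¬ij ¬ji e = no-chord-at-t i ¬ji ¬ij (Adj-sym e)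
    no-chord (suc i) (suc j) _   ¬ij ¬ji e with induced p i j e
    ... | inj₁ ij = ¬ij (inj₁ (cong suc ij))
    ... | inj₂ ji = ¬ji (inj₁ (cong suc ji))

  -- In the second case `w` is the first neighbour of `t` on the path and `ys` leads up to it. The
  -- inclusion of `ys` in `xs` carries separation from earlier vertices over to this segment.
  scan : ∀ {t x y xs} → Path x y xs → All (t ≢_) (x ∷ xs) → Adj t y →
         All (Adj t) (x ∷ xs) ⊎
         (¬ Adj t x × ∃[ w ] ∃[ ys ] (Path x w ys × (∀ {v} → v ∈ₗ ys → v ∈ₗ xs) ×
                                      Adj t w × All (λ v → Adj t v → v ≡ w) ys))
  scan stop _ ty = inj₁ (ty ∷ [])
  scan {t} {x} (step r s p) (t≢x ∷ t∉p) ty with adj? t x | scan p t∉p ty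
  ... | yes tx | inj₁ all = inj₁ (tx ∷ all)
  ... | no ¬tx | inj₁ (tz ∷ _) =
    inj₂ (¬tx , _ , _ , step r [] stop , (λ { (here refl) → here refl }) , tz , (λ _ → refl) ∷ [])
  ... | no ¬tx | inj₂ (¬tz , w , ys , q , ys⊆ , tw , only) =
    inj₂ (¬tx , w , _ , step r (anti-mono ys⊆ s) q ,
          (λ { (here refl) → here refl ; (there v∈) → there (ys⊆ v∈) }) , tw , (⊥-elim ∘ ¬tz) ∷ only)
  ... | yes tx | inj₂ (¬tz , w , [] , stop , _ , tw , _) = ⊥-elim (¬tz tw)
  -- A gap between the neighbours `x` and `w` of `t` makes a hole.
  ... | yes tx | inj₂ (¬tz , w , _ ∷ _ , q , ys⊆ , tw , only) with t∉p
  ...   | t≢z ∷ t∉zs = ⊥-elim (no-hole (step r (anti-mono ys⊆ s) q) (s≤s (s≤s z≤n))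
                         (t≢x ∷ t≢z ∷ anti-mono ys⊆ t∉zs) tx tw ((⊥-elim ∘ ¬tz) ∷ only))

  fan : ∀ {t x y xs} → Path x y xs → All (t ≢_) (x ∷ xs) → Adj t x → Adj t y → All (Adj t) (x ∷ xs)
  fan p t∉p tx ty with scan p t∉p ty
  ... | inj₁ all       = all
  ... | inj₂ (¬tx , _) = ⊥-elim (¬tx tx)

  penultimate : ∀ {x y xs} → Path x y xs → x ≢ y → ∃[ p ] (p ∈ₗ (x ∷ xs) × Adj p y)
  penultimate stop x≢y = ⊥-elim (x≢y refl)
  penultimate (step {y = y} {z = z} r s q) _ with z ≟ y
  ... | yes refl = _ , here refl , r
  ... | no z≢y   = let p , p∈ , e = penultimate q z≢y in p , there p∈ , e

  -- Growing a convex union of cliques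

  Outside : List (Subset n) → Fin n → Fin n → Set
  Outside Cs a b = Adj a b × ¬ InV' G Cs a × ¬ InV' G Cs b

  Outside-sym : ∀ {Cs a b} → Outside Cs a b → Outside Cs b a
  Outside-sym (e , a∉ , b∉) = Adj-sym e , b∉ , a∉

  Outside-tail : ∀ {C Cs a b} → Star (Outside (C ∷ Cs)) a b → Star (Outside Cs) a b
  Outside-tail = Star.map λ (e , a∉ , b∉) → e , a∉ ∘ there , b∉ ∘ there

  walk-end-outside : ∀ {Cs a b} → ¬ InV' G Cs a → Star (Outside Cs) a b → ¬ InV' G Cs b
  walk-end-outside a∉ ε                  = a∉
  walk-end-outside _  ((_ , _ , b∉) ◅ w) = walk-end-outside b∉ w

  -- Applied to edges, `flat` says that G′ is induced; applied to the meet, it supplies the clique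
  -- to attach to. In `convex`, `a` is required to be outside separately because the walk may be
  -- empty.
  record State (Cs : List (Subset n)) (Ec : Subset n → Subset n → Set) : Set₁ where
    field
      reach  : Reach G Cs Ec
      tree   : IsTree (CGAdj Cs Ec)
      seed   : ∃[ u ] InV' G Cs u
      convex : ∀ {u w a b} → InV' G Cs u → InV' G Cs w → u ≢ w → Adj u a → ¬ InV' G Cs a →
               Star (Outside Cs) a b → Adj b w → Adj u w
      flat   : ∀ T → IsClique G T → (∀ {x} → x ∈ T → InV' G Cs x) → Any (T ⊆_) Cs

  initial : Fin n → Σ[ Cs ∈ List (Subset n) ] Σ[ Ec ∈ (Subset n → Subset n → Set) ] State Cs Ec
  initial v₀ with extend-to-MaxClique ⁅ v₀ ⁆
    (λ x∈ y∈ x≢y → ⊥-elim (x≢y (trans (x∈⁅y⁆⇒x≡y v₀ x∈) (sym (x∈⁅y⁆⇒x≡y v₀ y∈)))))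
  ... | C , v₀∈C , cC , maxC = C ∷ [] , _ , record
    { reach  = disjoint C start (cC , maxC) (λ (inV , _) → case-[] (inV v₀ (v₀∈C (x∈⁅x⁆ v₀)))) (λ _ _ ())
    ; tree   = (zero , λ { zero zero → ε }) , λ { (suc zero) (s≤s ()) ; (suc (suc _)) _ f (inj , _) → one-vertex f inj }
    ; seed   = v₀ , here (v₀∈C (x∈⁅x⁆ v₀))
    ; convex = λ { (here u∈) (here w∈) u≢w _ _ _ _ → cC u∈ w∈ u≢w }
    ; flat   = λ T _ T⊆ → here λ x∈T → case-here (T⊆ x∈T)
    }
    where
    case-[] : ∀ {x} → ¬ InV' G [] x
    case-[] ()
    case-here : ∀ {x} → InV' G (C ∷ []) x → x ∈ C
    case-here (here x∈C) = x∈C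
    one-vertex : ∀ {k} (f : Fin (suc (suc k)) → Fin 1) → ¬ (∀ {i j} → f i ≡ f j → i ≡ j)
    one-vertex f inj with f zero in eq₀ | f (suc zero) in eq₁
    ... | zero | zero with inj {zero} {suc zero} (trans eq₀ (sym eq₁))
    ...   | ()

  module Grow {Cs Ec} (state : State Cs Ec) where
    open State state

    nbrs? : ∀ h u → Dec (InV' G Cs u × Adj h u)
    nbrs? h u = inV? Cs u ×-dec adj? h u

    nbrs : Fin n → Subset n
    nbrs h = fromDec (nbrs? h)

    Best : Fin n → Set
    Best h = ∀ h′ → ¬ InV' G Cs h′ → nbrs h ⊆ nbrs h′ → nbrs h′ ⊆ nbrs h

    -- Keeping `nbrs h` inside the new neighbourhood ensures that the latter is nonempty, so the
    -- clique added next meets G′.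
    improve : ∀ h → ¬ InV' G Cs h → ∃[ h′ ] (¬ InV' G Cs h′ × nbrs h ⊆ nbrs h′ × Best h′)
    improve h h∉ = go h h∉ (⊃-wellFounded (nbrs h))
      where
      go : ∀ h → ¬ InV' G Cs h → Acc _⊃_ (nbrs h) → ∃[ h′ ] (¬ InV' G Cs h′ × nbrs h ⊆ nbrs h′ × Best h′)
      go h h∉ (acc rec) with any? (λ h′ → ¬? (inV? Cs h′) ×-dec (nbrs h ⊂? nbrs h′))
      ... | no none = h , h∉ , ⊆-refl , λ h′ h′∉ ⊆h′ {u} u∈ →
              decidable-stable (u ∈? nbrs h) λ u∉ → none (h′ , h′∉ , ⊆h′ , u , u∈ , u∉)
      ... | yes (h′ , h′∉ , h⊂h′) =
        let h″ , h″∉ , ⊆h″ , best = go h′ h′∉ (rec h⊂h′)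
        in h″ , h″∉ , ⊆-trans (proj₁ h⊂h′) ⊆h″ , best

    crossing : ∀ {v u} → Star Adj v u → ¬ InV' G Cs v → InV' G Cs u →
               ∃[ h ] ∃[ s ] (¬ InV' G Cs h × s ∈ nbrs h)
    crossing ε v∉ u∈ = ⊥-elim (v∉ u∈)
    crossing {v} (_◅_ {j = z} e w) v∉ u∈ with inV? Cs z
    ... | yes z∈ = v , z , v∉ , ∈-fromDec⁺ (nbrs? v) (z∈ , e)
    ... | no  z∉ = crossing w z∉ u∈

    module Add h s (h∉ : ¬ InV' G Cs h) (s∈ : s ∈ nbrs h) (best : Best h) where

      S : Subset n
      S = nbrs h

      S⇒InV' : ∀ {x} → x ∈ S → InV' G Cs x
      S⇒InV' = proj₁ ∘ ∈-fromDec⁻ (nbrs? h)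

      S⇒Adj : ∀ {x} → x ∈ S → Adj h x
      S⇒Adj = proj₂ ∘ ∈-fromDec⁻ (nbrs? h)

      S-clique : IsClique G S
      -- Convexity along the empty walk at `h`.
      S-clique x∈ y∈ x≢y = convex (S⇒InV' x∈) (S⇒InV' y∈) x≢y (Adj-sym (S⇒Adj x∈)) h∉ ε (S⇒Adj y∈)

      hS-clique : IsClique G (⁅ h ⁆ ∪ S)
      hS-clique {x} {y} x∈ y∈ x≢y with x∈p∪q⁻ ⁅ h ⁆ S x∈ | x∈p∪q⁻ ⁅ h ⁆ S y∈
      ... | inj₁ x∈h | inj₁ y∈h = ⊥-elim (x≢y (trans (x∈⁅y⁆⇒x≡y h x∈h) (sym (x∈⁅y⁆⇒x≡y h y∈h))))
      ... | inj₁ x∈h | inj₂ y∈S = subst (λ v → Adj v y) (sym (x∈⁅y⁆⇒x≡y h x∈h)) (S⇒Adj y∈S)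
      ... | inj₂ x∈S | inj₁ y∈h = subst (Adj x) (sym (x∈⁅y⁆⇒x≡y h y∈h)) (Adj-sym (S⇒Adj x∈S))
      ... | inj₂ x∈S | inj₂ y∈S = S-clique x∈S y∈S x≢y

      extension : Σ[ C ∈ Subset n ] (⁅ h ⁆ ∪ S ⊆ C × IsMaxClique G C)
      extension = extend-to-MaxClique (⁅ h ⁆ ∪ S) hS-clique

      C : Subset n
      C = proj₁ extension

      maxC : IsMaxClique G C
      maxC = proj₂ (proj₂ extension)

      h∈C : h ∈ C
      h∈C = proj₁ (proj₂ extension) (p⊆p∪q S (x∈⁅x⁆ h))

      S⊆C : S ⊆ C
      S⊆C = proj₁ (proj₂ extension) ∘ q⊆p∪q ⁅ h ⁆ S

      C∩V'⊆S : ∀ {x} → x ∈ C → InV' G Cs x → x ∈ S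
      C∩V'⊆S x∈C x∈V = ∈-fromDec⁺ (nbrs? h) (x∈V , proj₁ maxC h∈C x∈C λ { refl → h∉ x∈V })

      fresh : ¬ ContainedIn' G Cs C
      fresh (inV , _) = h∉ (inV h h∈C)

      d : Fin (length Cs)
      d = index (flat S S-clique S⇒InV')

      S⊆D : S ⊆ lookup Cs d
      S⊆D = lookup-index (flat S S-clique S⇒InV')

      S-isMeet : IsMeet G Cs C S
      S-isMeet = (λ x∈S → S⊆C x∈S , S⇒InV' x∈S) ,
                 (λ x∈S y∈S x≢y → x≢y , lose (∈-lookup d) (S⊆D x∈S , S⊆D y∈S)) ,
                 λ T inT _ _ x∈T → let x∈C , x∈V = inT x∈T in C∩V'⊆S x∈C x∈V

      Ec′ : Subset n → Subset n → Set
      Ec′ A B = Ec A B ⊎ MeetEdge Cs C (λ _ → lookup Cs d) A B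

      reach′ : Reach G (C ∷ Cs) Ec′
      reach′ = meet C reach maxC fresh (s , S⊆C s∈ , S⇒InV' s∈) (λ _ → lookup Cs d)
        -- Every meet lies in `S`, hence in the one clique at `d`, so a constant choice is
        -- admissible.
        λ T (inT , _) → ∈-lookup d , λ x∈T → let x∈C , x∈V = inT x∈T in S⊆D (C∩V'⊆S x∈C x∈V)

      C∉Cs : ¬ C ∈ₗ Cs
      C∉Cs = fresh⇒∉ fresh

      lookup≢C : ∀ i → lookup Cs i ≢ C
      lookup≢C i eq = C∉Cs (subst (_∈ₗ Cs) eq (∈-lookup i))

      tree′ : IsTree (CGAdj (C ∷ Cs) Ec′)
      tree′ = attach-leaf {R′ = CGAdj (C ∷ Cs) Ec′} d (Sum.map inj₁ inj₁) (λ {i} {j} → Sum.map (old i) (old j))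
                Sum.swap (inj₁ (inj₂ (refl , S , S-isMeet , refl))) (λ {x} → only x) tree
        where
        old : ∀ i {B} → Ec′ (lookup Cs i) B → Ec (lookup Cs i) B
        old i (inj₁ e)        = e
        old i (inj₂ (eq , _)) = ⊥-elim (lookup≢C i eq)
        only : ∀ x → CGAdj (C ∷ Cs) Ec′ zero x → x ≡ suc d
        only zero    e                              = ⊥-elim (CGAdj⇒≢ reach′ {zero} {zero} e refl)
        only (suc j) (inj₁ (inj₁ e))                = ⊥-elim (C∉Cs (proj₁ (Ec-members reach e)))
        only (suc j) (inj₁ (inj₂ (_ , _ , _ , eq))) =
          cong suc (Unique⇒lookup-injective (Reach⇒Unique reach) (sym eq))
        only (suc j) (inj₂ (inj₁ e))                = ⊥-elim (C∉Cs (proj₁ (proj₂ (Ec-members reach e))))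
        only (suc j) (inj₂ (inj₂ (eq , _)))         = ⊥-elim (lookup≢C j eq)

      -- Here the maximal choice of `h` enters: if `t` is complete to `S`, its old neighbourhood
      -- contains that of `h` and so cannot exceed it.
      absorbed : ∀ {t} → (∀ {x} → x ∈ S → Adj t x) → ¬ InV' G Cs t → ∀ {x} → InV' G Cs x → Adj t x → x ∈ S
      absorbed {t} tS t∉ x∈V tx =
        best t t∉ (λ x∈S → ∈-fromDec⁺ (nbrs? t) (S⇒InV' x∈S , tS x∈S)) (∈-fromDec⁺ (nbrs? t) (x∈V , tx))

      C-complete-to-S : ∀ {t} → t ∈ C → ¬ InV' G Cs t → ∀ {x} → x ∈ S → Adj t x
      C-complete-to-S t∈C t∉ x∈S = proj₁ maxC t∈C (S⊆C x∈S) λ { refl → t∉ (S⇒InV' x∈S) }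

      -- A new vertex `t` of `T` lies in `C` and is complete to `S`, so the old vertices of `T` are
      -- absorbed into `S` and all of `T` lies in `C`.
      flat′ : ∀ T → IsClique G T → (∀ {x} → x ∈ T → InV' G (C ∷ Cs) x) → Any (T ⊆_) (C ∷ Cs)
      flat′ T cT T⊆ with any? (λ t → (t ∈? T) ×-dec ¬? (inV? Cs t))
      ... | no none = there (flat T cT λ {x} x∈T → decidable-stable (inV? Cs x) λ x∉ → none (x , x∈T , x∉))
      ... | yes (t , t∈T , t∉) = here T⊆C
        where
        t∈C : t ∈ C
        t∈C = Any.head t∉ (T⊆ t∈T)
        T⊆C : T ⊆ C
        T⊆C {x} x∈T with T⊆ x∈T
        ... | here x∈C  = x∈C
        ... | there x∈V = S⊆C (absorbed (C-complete-to-S t∈C t∉) t∉ x∈V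
                                (cT t∈T x∈T λ { refl → t∉ x∈V }))

      -- Otherwise an induced path from w to u would contain a vertex complete
      -- to S ∪ {u}, contradicting the choice of h.
      not-linked : ∀ {u w a} → InV' G Cs u → u ∉ C → w ∈ C → ¬ InV' G Cs w →
                   Star (Outside Cs) w a → Adj a u → ⊥
      not-linked {u} {w} {a} u∈V u∉C w∈C w∉V walk au = u∉C (S⊆C (absorbed pS p∉V u∈V pu))
        where
        Allowed : Fin n → Set
        -- On the path only `u` may be old, so the vertex before `u` is outside G′ and `absorbed`
        -- applies to it.
        Allowed x = x ≡ u ⊎ ¬ InV' G Cs x
        w≢u : w ≢ u
        w≢u refl = w∉V u∈V
        wS : ∀ {x} → x ∈ S → Adj w x
        wS = C-complete-to-S w∈C w∉V
        induced-path : ∃[ xs ] (Path w u xs × All Allowed xs)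
        induced-path = Star⇒Path near
          (Star.map (λ (e , _ , b∉) → e , inj₂ b∉) walk ◅◅ ((au , inj₁ refl) ◅ ε))
        path = proj₁ (proj₂ induced-path)
        on-path : All Allowed (w ∷ proj₁ induced-path)
        on-path = inj₂ w∉V ∷ proj₂ (proj₂ induced-path)
        p = proj₁ (penultimate path w≢u)
        p∈ = proj₁ (proj₂ (penultimate path w≢u))
        pu : Adj p u
        pu = proj₂ (proj₂ (penultimate path w≢u))
        p∉V : ¬ InV' G Cs p
        p∉V with All.lookup on-path p∈
        ... | inj₁ p≡u = ⊥-elim (Adj⇒≢ pu p≡u)
        ... | inj₂ p∉  = p∉
        -- `x` sees both ends of the induced path, `w` within `C` and `u` by the old convexity, so
        -- by `fan` it sees every vertex on it.
        pS : ∀ {x} → x ∈ S → Adj p x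
        pS {x} x∈S = Adj-sym (All.lookup (fan path (All.map off on-path) (Adj-sym (wS x∈S)) xu) p∈)
          where
          x≢u : x ≢ u
          x≢u refl = u∉C (S⊆C x∈S)
          xu : Adj x u
          xu = convex (S⇒InV' x∈S) u∈V x≢u (Adj-sym (wS x∈S)) w∉V walk au
          off : ∀ {v} → Allowed v → x ≢ v
          off (inj₁ refl) = x≢u
          off (inj₂ v∉) refl = v∉ (S⇒InV' x∈S)

      convex′ : ∀ {u w a b} → InV' G (C ∷ Cs) u → InV' G (C ∷ Cs) w → u ≢ w → Adj u a →
                ¬ InV' G (C ∷ Cs) a → Star (Outside (C ∷ Cs)) a b → Adj b w → Adj u w
      convex′ {u} {w} {a} {b} u∈ w∈ u≢w ua a∉ walk bw with inV? Cs u | inV? Cs w | u ∈? C | w ∈? C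
      ... | _       | _       | yes u∈C | yes w∈C = proj₁ maxC u∈C w∈C u≢w
      ... | yes u∈V | yes w∈V | _       | _       = convex u∈V w∈V u≢w ua (a∉ ∘ there) (Outside-tail walk) bw
      ... | no u∉V  | _       | no u∉C  | _       = ⊥-elim (u∉V (Any.tail u∉C u∈))
      ... | _       | no w∉V  | _       | no w∉C  = ⊥-elim (w∉V (Any.tail w∉C w∈))
      -- In the two mixed cases an old vertex off `C` would be linked to a new vertex of `C` outside
      -- the old G′.
      ... | yes u∈V | no w∉V  | no u∉C  | yes w∈C =
        ⊥-elim (not-linked u∈V u∉C w∈C w∉V
          ((Adj-sym bw , w∉V , walk-end-outside a∉ walk ∘ there) ◅ Star.reverse Outside-sym (Outside-tail walk))
          (Adj-sym ua))
      ... | no u∉V  | yes w∈V | yes u∈C | no w∉C  =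
        ⊥-elim (not-linked w∈V w∉C u∈C u∉V ((ua , u∉V , a∉ ∘ there) ◅ Outside-tail walk) bw)

      state′ : State (C ∷ Cs) Ec′
      state′ = record
        { reach  = reach′
        ; tree   = tree′
        ; seed   = h , here h∈C
        ; convex = convex′
        ; flat   = flat′
        }

  State⇒Complete' : ∀ {Cs Ec} → State Cs Ec → (∀ x → InV' G Cs x) → Complete' G Cs
  State⇒Complete' {Cs} state inV = inV , λ x y → (λ xy → Adj⇒≢ xy , covers xy) , adjacent
    where
    open State state
    covers : ∀ {x y} → Adj x y → Any (λ C → x ∈ C × y ∈ C) Cs
    covers {x} {y} xy = Any.map (λ ⊆C → ⊆C (p⊆p∪q ⁅ y ⁆ (x∈⁅x⁆ x)) , ⊆C (q⊆p∪q ⁅ x ⁆ ⁅ y ⁆ (x∈⁅x⁆ y)))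
                          (flat (⁅ x ⁆ ∪ ⁅ y ⁆) edge λ _ → inV _)
      where
      edge : IsClique G (⁅ x ⁆ ∪ ⁅ y ⁆)
      edge {a} {b} a∈ b∈ a≢b with x∈p∪q⁻ ⁅ x ⁆ ⁅ y ⁆ a∈ | x∈p∪q⁻ ⁅ x ⁆ ⁅ y ⁆ b∈
      ... | inj₁ a≡x | inj₁ b≡x = ⊥-elim (a≢b (trans (x∈⁅y⁆⇒x≡y x a≡x) (sym (x∈⁅y⁆⇒x≡y x b≡x))))
      ... | inj₁ a≡x | inj₂ b≡y = subst₂ Adj (sym (x∈⁅y⁆⇒x≡y x a≡x)) (sym (x∈⁅y⁆⇒x≡y y b≡y)) xy
      ... | inj₂ a≡y | inj₁ b≡x = subst₂ Adj (sym (x∈⁅y⁆⇒x≡y y a≡y)) (sym (x∈⁅y⁆⇒x≡y x b≡x)) (Adj-sym xy)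
      ... | inj₂ a≡y | inj₂ b≡y = ⊥-elim (a≢b (trans (x∈⁅y⁆⇒x≡y y a≡y) (sym (x∈⁅y⁆⇒x≡y y b≡y))))
    adjacent : ∀ {x y} → E' G Cs x y → Adj x y
    adjacent (x≢y , any) =
      let x∈ , y∈ = lookup-index any
      in proj₁ (All.lookup (Reach⇒MaxCliques reach) (∈-lookup (index any))) x∈ y∈ x≢y

  -- Assembling the clique tree

  CliqueTree : Set₁
  CliqueTree = Σ[ Cs ∈ List (Subset n) ] Σ[ Ec ∈ (Subset n → Subset n → Set) ]
                 (InHtilde G Cs Ec × IsTree (CGAdj Cs Ec))

  complete : Connected G → ∀ {Cs Ec} → State Cs Ec → Acc _⊃_ (fromDec (inV? Cs)) → CliqueTree
  complete conn {Cs} {Ec} state (acc rec) with any? (λ v → ¬? (inV? Cs v))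
  ... | no none =
    Cs , Ec , (reach , State⇒Complete' state λ x → decidable-stable (inV? Cs x) λ x∉ → none (x , x∉)) , tree
    where open State state
  ... | yes (v , v∉) =
    let open State state
        open Grow state
        -- A walk in G from a missing vertex to G′ must enter G′ somewhere, which gives an outside
        -- vertex with an old neighbour.
        h₀ , s , h₀∉ , s∈     = crossing (proj₂ conn v (proj₁ seed)) v∉ (proj₂ seed)
        h , h∉ , h₀⊆h , best = improve h₀ h₀∉
        module A             = Add h s h∉ (h₀⊆h s∈) best
    in complete conn A.state′ (rec
         ( ∈-fromDec⁺ (inV? (A.C ∷ Cs)) ∘ there ∘ ∈-fromDec⁻ (inV? Cs)
         , h , ∈-fromDec⁺ (inV? (A.C ∷ Cs)) (here A.h∈C) , h∉ ∘ ∈-fromDec⁻ (inV? Cs)))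

  clique-tree : Connected G → CliqueTree
  clique-tree conn = let _ , _ , state = initial (proj₁ conn) in complete conn state (⊃-wellFounded _)

theorem5 : ∀ {n} (G : Graph n) → Connected G →
    ((Chordal G → Σ[ Cs ∈ List (Subset n) ] Σ[ Ec ∈ (Subset n → Subset n → Set) ]
    (InHtilde G Cs Ec × IsTree (CGAdj Cs Ec)))
    × ((Σ[ Cs ∈ List (Subset n) ] Σ[ Ec ∈ (Subset n → Subset n → Set) ]
    (InHtilde G Cs Ec × IsTree (CGAdj Cs Ec))) → Chordal G))
    × (Chordal G → ∀ (Cs : List (Subset n)) (Ec : Subset n → Subset n → Set) →
    InHtilde G Cs Ec → (i : Fin (length Cs)) → IsLeaf (CGAdj Cs Ec) i →
    HasNonPublicVertex G (lookup Cs i))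
theorem5 G conn =
  ( (λ chordal → ChordalGraph.clique-tree G chordal conn)
  , λ (_ , _ , inH , _ , acyclic) → CliqueGraph.Acyclic⇒Chordal G inH acyclic)
  , λ _ _ _ inH → CliqueGraph.leaf⇒HasNonPublicVertex G inH
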